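{- Let $i,j,k\in\mathbb{Z}$. The number $f_{6N}(i,j,k)$ of shortest paths from $q=(0,0,0)$ to $p=(i,j,k)$ in the 6-neighborhood of the cubic grid $\mathbb{Z}^3$ is $$f_{6N}(i,j,k)=\frac{(|i|+|j|+|k|)!}{|i|!\,|j|!\,|k|!}.$$
   Context: The cubic grid is $\mathbb{Z}^3$. For $r=(x_r,y_r,z_r)\in\mathbb{Z}^3$, its 6-neighborhood $N_6(r)$ is the set of points $s=(x_s,y_s,z_s)\in\mathbb{Z}^3$ with $\max\{|x_r-x_s|,|y_r-y_s|,|z_r-z_s|\}\le 1$ and $|x_r-x_s|+|y_r-y_s|+|z_r-z_s|\le 1$. A path of length $n$ from $q$ to $p$ in the 6-neighborhood is a sequence of points $q=r_0,r_1,\dots,r_n=p$ of $\mathbb{Z}^3$ with $r_{t+1}\in N_6(r_t)$ for $0\le t<n$. A shortest path is a path of minimal length among all paths from $q$ to $p$ in the given neighborhood; two paths are distinct if they differ as sequences of points. -}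

module Defs where

open import Data.Fin using (Fin; inject₁; suc)
open import Data.Integer using (ℤ; ∣_∣; _-_)
open import Data.Nat using (ℕ; suc; _+_; _*_; _⊔_; _≤_; _!; NonZero)
open import Data.Nat.Properties using (m*n≢0; _!≢0; _!*_!≢0)
open import Data.Product using (Σ; _×_; _,_)
open import Data.Vec using (Vec; head; last; lookup)
open import Function.Bundles using (Inverse)
open import Level using (0ℓ)
open import Relation.Binary.Bundles using (Setoid)
open import Relation.Binary.PropositionalEquality using (_≡_; setoid)
import Relation.Binary.Construct.On as On

Point : Set
Point = ℤ × ℤ × ℤ

infix 4 _∈N₆_

-- The bounds are not strict, so every point belongs to its own neighborhood.
_∈N₆_ : Point → Point → Set
(xₛ , yₛ , zₛ) ∈N₆ (xᵣ , yᵣ , zᵣ) =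
    (∣ xᵣ - xₛ ∣ ⊔ ∣ yᵣ - yₛ ∣ ⊔ ∣ zᵣ - zₛ ∣ ≤ 1)
  × (∣ xᵣ - xₛ ∣ + ∣ yᵣ - yₛ ∣ + ∣ zᵣ - zₛ ∣ ≤ 1)

-- A path of length n has n + 1 points r₀ , … , rₙ.
IsPath : Point → Point → (n : ℕ) → Vec Point (suc n) → Set
IsPath q p n r =
    head r ≡ q
  × last r ≡ p
  × (∀ (t : Fin n) → lookup r (suc t) ∈N₆ lookup r (inject₁ t))

record ShortestPath (q p : Point) : Set where
  field
    len     : ℕ
    points  : Vec Point (suc len)
    isPath  : IsPath q p len points
    minimal : ∀ m (s : Vec Point (suc m)) → IsPath q p m s → len ≤ m

  pointSequence : Σ ℕ (λ n → Vec Point (suc n))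
  pointSequence = len , points

-- Paths are identified when their point sequences agree; the proofs that they
-- are shortest paths are ignored.
shortestPaths : Point → Point → Setoid 0ℓ 0ℓ
shortestPaths q p =
  On.setoid (setoid (Σ ℕ (λ n → Vec Point (suc n))))
            (ShortestPath.pointSequence {q} {p})

HasCardinality : Setoid 0ℓ 0ℓ → ℕ → Set
HasCardinality S n = Inverse (setoid (Fin n)) S

factorials≢0 : ∀ a b c → NonZero (a ! * b ! * c !)
factorials≢0 a b c = m*n≢0 (a ! * b !) (c !) {{a !* b !≢0}} {{c !≢0}}

{-# OPTIONS --safe #-}
-- A step changes one coordinate by at most 1, so every path to p is at least as
-- long as the ℓ¹-distance to p.  Hence a path is shortest exactly when each of
-- its steps moves one coordinate one unit towards p, and such paths correspond
-- to words in three letters with |i|, |j| and |k| occurrences.  Deleting the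
-- first letter gives the recursion for the number of these words; multiplied by
-- |i|! |j|! |k|! it becomes (a + b + c) · n! = (n + 1)! with a + b + c = n + 1.
module Submission where

open import Defs
open import Data.Empty using (⊥)
open import Data.Fin using (Fin; zero; suc)
open import Data.Fin.Properties using (+↔⊎; 0↔⊥)
open import Data.Integer using (ℤ; +_; -[1+_]; +[1+_]; 0ℤ; 1ℤ; -1ℤ; ∣_∣)
import Data.Integer as ℤ
import Data.Integer.Properties as ℤ
import Data.Integer.Tactic.RingSolver as ℤ
open import Data.Nat using (ℕ; zero; suc; _+_; _*_; _!; _≤_; z≤n; s≤s; s≤s⁻¹; NonZero)
open import Data.Nat.Properties
import Data.Nat.Tactic.RingSolver as ℕ
open import Data.Product using (Σ; _×_; _,_; proj₁; proj₂)
open import Data.Product.Properties using (,-injectiveʳ-UIP)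
open import Data.Rational using (_/_)
open import Data.Rational.Properties using (fromℚᵘ-cong)
open import Data.Rational.Unnormalised using (mkℚᵘ; *≡*)
open import Data.Sum using (_⊎_; inj₁; inj₂; [_,_])
open import Data.Sum.Function.Propositional using (_⊎-↔_)
open import Data.Vec using (Vec; []; _∷_)
open import Data.Vec.Properties using (∷-injectiveˡ; ∷-injectiveʳ)
open import Function.Base using (_∘_)
open import Function.Bundles using (_↔_; mk↔ₛ′; Inverse)
open import Function.Construct.Composition using (inverse)
open import Function.Properties.Inverse using (↔-trans)
open import Level using (Level)
open import Relation.Binary.PropositionalEquality
  using (_≡_; _≢_; refl; sym; trans; cong; cong₂; subst; setoid; module ≡-Reasoning)
open import Relation.Nullary using (contradiction)

private variable
  ℓ : Level
  n a b c : ℕ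
  x x′ y y′ z z′ : ℤ

-- Words with given letter counts

-- The length is an index of its own, so that it matches `Vec Point n` and drives the recursion of
-- `count`. A word exists only when `n` is `a + b + c`.
data Word : (n a b c : ℕ) → Set where
  []    : Word 0 0 0 0
  xstep : Word n a b c → Word (suc n) (suc a) b c
  ystep : Word n a b c → Word (suc n) a (suc b) c
  zstep : Word n a b c → Word (suc n) a b (suc c)

-- Yields a path whose length is the distance, against which the minimality of an arbitrary shortest
-- path is tested.
someWord : ∀ a b c → Word (a + b + c) a b c
someWord (suc a) b c          = xstep (someWord a b c)
someWord zero (suc b) c       = ystep (someWord zero b c)
someWord zero zero (suc c)    = zstep (someWord zero zero c)
someWord zero zero zero       = []

-- The default `d` covers a letter with count zero, which cannot come first: `⊥` for sets of words,
-- 0 for their sizes.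
atPred : {A : Set ℓ} → A → (ℕ → A) → ℕ → A
atPred d f zero    = d
atPred d f (suc n) = f n

Uncons : (n a b c : ℕ) → Set
Uncons n a b c =
    atPred ⊥ (λ a′ → Word n a′ b c) a
  ⊎ atPred ⊥ (λ b′ → Word n a b′ c) b
  ⊎ atPred ⊥ (λ c′ → Word n a b c′) c

uncons : Word (suc n) a b c → Uncons n a b c
uncons (xstep w) = inj₁ w
uncons (ystep w) = inj₂ (inj₁ w)
uncons (zstep w) = inj₂ (inj₂ w)

Word-suc↔ : ∀ n a b c → Uncons n a b c ↔ Word (suc n) a b c
Word-suc↔ n a b c = mk↔ₛ′ cons uncons cons-uncons
  [ uncons-consˣ a , [ uncons-consʸ b , uncons-consᶻ c ] ]
  where
  -- The letter count is an explicit argument because `atPred` reduces only once it is matched.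
  consˣ : ∀ a → atPred ⊥ (λ a′ → Word n a′ b c) a → Word (suc n) a b c
  consˣ (suc a) = xstep

  consʸ : ∀ b → atPred ⊥ (λ b′ → Word n a b′ c) b → Word (suc n) a b c
  consʸ (suc b) = ystep

  consᶻ : ∀ c → atPred ⊥ (λ c′ → Word n a b c′) c → Word (suc n) a b c
  consᶻ (suc c) = zstep

  cons : Uncons n a b c → Word (suc n) a b c
  cons = [ consˣ a , [ consʸ b , consᶻ c ] ]

  cons-uncons : ∀ w → cons (uncons w) ≡ w
  cons-uncons (xstep w) = refl
  cons-uncons (ystep w) = refl
  cons-uncons (zstep w) = refl

  uncons-consˣ : ∀ a w → uncons (consˣ a w) ≡ inj₁ w
  uncons-consˣ (suc a) w = refl

  uncons-consʸ : ∀ b w → uncons (consʸ b w) ≡ inj₂ (inj₁ w)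
  uncons-consʸ (suc b) w = refl

  uncons-consᶻ : ∀ c w → uncons (consᶻ c w) ≡ inj₂ (inj₂ w)
  uncons-consᶻ (suc c) w = refl

-- Counting words by their first letter

count : (n a b c : ℕ) → ℕ
count zero zero zero zero       = 1
count zero zero zero (suc c)    = 0
count zero zero (suc b) c       = 0
count zero (suc a) b c          = 0
count (suc n) a b c =
    atPred 0 (λ a′ → count n a′ b c) a
  + (atPred 0 (λ b′ → count n a b′ c) b
  +  atPred 0 (λ c′ → count n a b c′) c)

atPred-↔ : {f : ℕ → ℕ} {F : ℕ → Set} → (∀ m → Fin (f m) ↔ F m) →
           ∀ m → Fin (atPred 0 f m) ↔ atPred ⊥ F m
atPred-↔ f↔F zero    = 0↔⊥
atPred-↔ f↔F (suc m) = f↔F m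

count-↔ : ∀ n a b c → Fin (count n a b c) ↔ Word n a b c
count-↔ zero zero zero zero =
  mk↔ₛ′ (λ _ → []) (λ _ → zero) (λ { [] → refl }) (λ { zero → refl })
count-↔ zero zero zero (suc c) = mk↔ₛ′ (λ ()) (λ ()) (λ ()) (λ ())
count-↔ zero zero (suc b) c    = mk↔ₛ′ (λ ()) (λ ()) (λ ()) (λ ())
count-↔ zero (suc a) b c       = mk↔ₛ′ (λ ()) (λ ()) (λ ()) (λ ())
count-↔ (suc n) a b c =
  ↔-trans
    (↔-trans +↔⊎
      (atPred-↔ (λ a′ → count-↔ n a′ b c) a
       ⊎-↔ ↔-trans +↔⊎
             (atPred-↔ (λ b′ → count-↔ n a b′ c) b
              ⊎-↔ atPred-↔ (λ c′ → count-↔ n a b c′) c)))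
    (Word-suc↔ n a b c)

-- A factor `m` splits off from `m !`. For `m` zero both sides vanish, so an absent letter fits the
-- same formula. In use, `t` is the product of the other two factorials.
atPred-*-! : ∀ (f : ℕ → ℕ) m t N → (∀ k → m ≡ suc k → f k * (k ! * t) ≡ N) →
             atPred 0 f m * (m ! * t) ≡ m * N
atPred-*-! f zero    t N h = refl
atPred-*-! f (suc m) t N h = trans (swap (f m) m (m !) t) (cong (suc m *_) (h m refl))
  where
  swap : ∀ u m v t → u * (suc m * v * t) ≡ suc m * (u * (v * t))
  swap = ℕ.solve-∀

count-*-! : ∀ n a b c → a + b + c ≡ n → count n a b c * (a ! * b ! * c !) ≡ n !
count-*-! zero zero zero zero refl = refl
count-*-! (suc n) a b c a+b+c≡1+n = begin
  (X + (Y + Z)) * (a ! * b ! * c !)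
    ≡⟨ expand X Y Z (a !) (b !) (c !) ⟩
  -- In each summand the factorial of the letter removed comes first, as `atPred-*-!` expects.
  X * (a ! * (b ! * c !)) + Y * (b ! * (a ! * c !)) + Z * (c ! * (a ! * b !))
    ≡⟨ cong₂ _+_ (cong₂ _+_ X≡a*n! Y≡b*n!) Z≡c*n! ⟩
  a * n ! + b * n ! + c * n !
    ≡⟨ factor a b c (n !) ⟩
  (a + b + c) * n !
    ≡⟨ cong (_* n !) a+b+c≡1+n ⟩
  suc n * n ! ∎
  where
  open ≡-Reasoning
  X Y Z : ℕ
  X = atPred 0 (λ a′ → count n a′ b c) a
  Y = atPred 0 (λ b′ → count n a b′ c) b
  Z = atPred 0 (λ c′ → count n a b c′) c

  expand : ∀ X Y Z u v w → (X + (Y + Z)) * (u * v * w) ≡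
           X * (u * (v * w)) + Y * (v * (u * w)) + Z * (w * (u * v))
  expand = ℕ.solve-∀

  yFirst : ∀ v u w → v * (u * w) ≡ u * v * w
  yFirst = ℕ.solve-∀

  factor : ∀ a b c N → a * N + b * N + c * N ≡ (a + b + c) * N
  factor = ℕ.solve-∀

  X≡a*n! : X * (a ! * (b ! * c !)) ≡ a * n !
  X≡a*n! = atPred-*-! _ a _ _ λ { a′ refl →
    trans (cong (count n a′ b c *_) (sym (*-assoc (a′ !) (b !) (c !))))
          (count-*-! n a′ b c (suc-injective a+b+c≡1+n)) }

  Y≡b*n! : Y * (b ! * (a ! * c !)) ≡ b * n !
  Y≡b*n! = atPred-*-! _ b _ _ λ { b′ refl →
    trans (cong (count n a b′ c *_) (yFirst (b′ !) (a !) (c !)))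
          (count-*-! n a b′ c
            (suc-injective (trans (sym (cong (_+ c) (+-suc a b′))) a+b+c≡1+n))) }

  Z≡c*n! : Z * (c ! * (a ! * b !)) ≡ c * n !
  Z≡c*n! = atPred-*-! _ c _ _ λ { c′ refl →
    trans (cong (count n a b c′ *_) (*-comm (c′ !) (a ! * b !)))
          (count-*-! n a b c′ (suc-injective (trans (sym (+-suc (a + b) c′)) a+b+c≡1+n))) }

-- Unit steps towards a coordinate

signum : ℤ → ℤ
signum (+ 0)    = 0ℤ
signum +[1+ _ ] = 1ℤ
signum -[1+ _ ] = -1ℤ

toward : ℤ → ℤ → ℤ
toward i x = x ℤ.+ signum (i ℤ.- x)

∣i-i∣≡0 : ∀ i → ∣ i ℤ.- i ∣ ≡ 0
∣i-i∣≡0 i = cong ∣_∣ (ℤ.+-inverseʳ i)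

∣i-j∣≡0⇒i≡j : ∀ i j → ∣ i ℤ.- j ∣ ≡ 0 → i ≡ j
∣i-j∣≡0⇒i≡j i j = ℤ.i-j≡0⇒i≡j i j ∘ ℤ.∣i∣≡0⇒i≡0

triangle : ∀ i x x′ → ∣ i ℤ.- x ∣ ≤ ∣ x ℤ.- x′ ∣ + ∣ i ℤ.- x′ ∣
triangle i x x′ = begin
  ∣ i ℤ.- x ∣                           ≡⟨ cong ∣_∣ (via i x x′) ⟩
  ∣ (x′ ℤ.- x) ℤ.+ (i ℤ.- x′) ∣         ≤⟨ ℤ.∣i+j∣≤∣i∣+∣j∣ (x′ ℤ.- x) (i ℤ.- x′) ⟩
  ∣ x′ ℤ.- x ∣ + ∣ i ℤ.- x′ ∣           ≡⟨ cong (_+ ∣ i ℤ.- x′ ∣) (ℤ.∣i-j∣≡∣j-i∣ x′ x) ⟩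
  ∣ x ℤ.- x′ ∣ + ∣ i ℤ.- x′ ∣           ∎
  where
  open ≤-Reasoning
  via : ∀ i x x′ → i ℤ.- x ≡ (x′ ℤ.- x) ℤ.+ (i ℤ.- x′)
  via = ℤ.solve-∀

∣i-toward∣ : ∀ i x → ∣ i ℤ.- x ∣ ≡ suc a → ∣ i ℤ.- toward i x ∣ ≡ a
∣i-toward∣ i x d = trans (cong ∣_∣ (regroup i x (signum (i ℤ.- x)))) (shrink (i ℤ.- x) d)
  where
  regroup : ∀ i x s → i ℤ.- (x ℤ.+ s) ≡ (i ℤ.- x) ℤ.- s
  regroup = ℤ.solve-∀

  shrink : ∀ δ → ∣ δ ∣ ≡ suc a → ∣ δ ℤ.- signum δ ∣ ≡ a
  shrink +[1+ _ ]     refl = refl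
  shrink -[1+ zero ]  refl = refl
  shrink -[1+ suc _ ] refl = refl

∣x-toward∣≡1 : ∀ i x → ∣ i ℤ.- x ∣ ≡ suc a → ∣ x ℤ.- toward i x ∣ ≡ 1
∣x-toward∣≡1 i x d = trans (cong ∣_∣ (cancel x (signum (i ℤ.- x)))) (unit (i ℤ.- x) d)
  where
  cancel : ∀ x s → x ℤ.- (x ℤ.+ s) ≡ ℤ.- s
  cancel = ℤ.solve-∀

  unit : ∀ δ → ∣ δ ∣ ≡ suc a → ∣ ℤ.- signum δ ∣ ≡ 1
  unit +[1+ _ ] _ = refl
  unit -[1+ _ ] _ = refl

toward≢ : ∀ i x → ∣ i ℤ.- x ∣ ≡ suc a → toward i x ≢ x
toward≢ i x d eq =
  contradiction (trans (sym (∣i-i∣≡0 x)) (subst (λ s → ∣ x ℤ.- s ∣ ≡ 1) eq (∣x-toward∣≡1 i x d))) λ ()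

-- Put δ = i - x and ε = x - x′, so that i - x′ = δ + ε with ε = 1 or ε = -1. If ε had the sign of
-- δ, the distance would grow; and δ is nonzero, its absolute value being a successor.
toward-unique : ∀ i x x′ → ∣ x ℤ.- x′ ∣ ≡ 1 → ∣ i ℤ.- x ∣ ≡ suc ∣ i ℤ.- x′ ∣ → x′ ≡ toward i x
toward-unique i x x′ u d = begin
  x′                          ≡⟨ regroup x x′ ⟩
  x ℤ.+ ℤ.- (x ℤ.- x′)        ≡⟨ cong (ℤ._+_ x) (opposite (i ℤ.- x) (x ℤ.- x′) u
                                   (trans d (cong (suc ∘ ∣_∣) (via i x x′)))) ⟩
  x ℤ.+ signum (i ℤ.- x)      ∎
  where
  open ≡-Reasoning
  regroup : ∀ x x′ → x′ ≡ x ℤ.+ ℤ.- (x ℤ.- x′)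
  regroup = ℤ.solve-∀

  via : ∀ i x x′ → i ℤ.- x′ ≡ (i ℤ.- x) ℤ.+ (x ℤ.- x′)
  via = ℤ.solve-∀

  opposite : ∀ δ ε → ∣ ε ∣ ≡ 1 → ∣ δ ∣ ≡ suc ∣ δ ℤ.+ ε ∣ → ℤ.- ε ≡ signum δ
  opposite +[1+ m ] (+ 1)    _ e = contradiction (suc-injective e) (m≢1+m+n m)
  opposite +[1+ m ] -[1+ 0 ] _ e = refl
  opposite -[1+ m ] (+ 1)    _ e = refl
  opposite -[1+ m ] -[1+ 0 ] _ e = contradiction (suc-injective e)
    (λ q → m≢1+m+n m (trans q (sym (cong suc (+-suc m _)))))

-- Steps in the 6-neighborhood

-- The neighborhood relation in a form fit for case analysis: matching identifies the unchanged
-- coordinates. `stay` is present because a point is its own neighbor.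
data Step : Point → Point → Set where
  stay    : Step (x , y , z) (x , y , z)
  along-x : ∣ x ℤ.- x′ ∣ ≡ 1 → Step (x , y , z) (x′ , y , z)
  along-y : ∣ y ℤ.- y′ ∣ ≡ 1 → Step (x , y , z) (x , y′ , z)
  along-z : ∣ z ℤ.- z′ ∣ ≡ 1 → Step (x , y , z) (x , y , z′)

Step⇒∈N₆ : ∀ {r s} → Step r s → s ∈N₆ r
Step⇒∈N₆ (stay {x} {y} {z})
  rewrite ∣i-i∣≡0 x | ∣i-i∣≡0 y | ∣i-i∣≡0 z = z≤n , z≤n
Step⇒∈N₆ (along-x {y = y} {z = z} u)
  rewrite u | ∣i-i∣≡0 y | ∣i-i∣≡0 z = s≤s z≤n , s≤s z≤n
Step⇒∈N₆ (along-y {x = x} {z = z} u)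
  rewrite u | ∣i-i∣≡0 x | ∣i-i∣≡0 z = s≤s z≤n , s≤s z≤n
Step⇒∈N₆ (along-z {x = x} {y = y} u)
  rewrite u | ∣i-i∣≡0 x | ∣i-i∣≡0 y = s≤s z≤n , s≤s z≤n

∈N₆⇒Step : ∀ {r s} → s ∈N₆ r → Step r s
∈N₆⇒Step {x , y , z} {x′ , y′ , z′} (_ , h)
  with ∣ x ℤ.- x′ ∣ in ex | ∣ y ℤ.- y′ ∣ in ey | ∣ z ℤ.- z′ ∣ in ez
-- Three naturals with sum at most 1 are all zero, or one of them is 1 and the others are zero;
-- these cases give the four constructors.
... | 0 | 0 | 0
  rewrite ∣i-j∣≡0⇒i≡j x x′ ex | ∣i-j∣≡0⇒i≡j y y′ ey | ∣i-j∣≡0⇒i≡j z z′ ez = stay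
... | 1 | 0 | 0
  rewrite ∣i-j∣≡0⇒i≡j y y′ ey | ∣i-j∣≡0⇒i≡j z z′ ez = along-x ex
... | 0 | 1 | 0
  rewrite ∣i-j∣≡0⇒i≡j x x′ ex | ∣i-j∣≡0⇒i≡j z z′ ez = along-y ey
... | 0 | 0 | 1
  rewrite ∣i-j∣≡0⇒i≡j x x′ ex | ∣i-j∣≡0⇒i≡j y y′ ey = along-z ez
∈N₆⇒Step (_ , s≤s ()) | 0 | 0 | suc (suc _)
∈N₆⇒Step (_ , s≤s ()) | 0 | 1 | suc _
∈N₆⇒Step (_ , s≤s ()) | 0 | suc (suc _) | _
∈N₆⇒Step (_ , s≤s ()) | 1 | 0 | suc _
∈N₆⇒Step (_ , s≤s ()) | 1 | suc _ | _
∈N₆⇒Step (_ , s≤s ()) | suc (suc _) | _ | _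

IsPath-∷ : ∀ {q q′ p} {rs : Vec Point n} → Step q q′ →
           IsPath q′ p n (q′ ∷ rs) → IsPath q p (suc n) (q ∷ q′ ∷ rs)
IsPath-∷ st (_ , lst , adj) = refl , lst , λ where
  zero    → Step⇒∈N₆ st
  (suc t) → adj t

IsPath-tail : ∀ {q q′ p} {rs : Vec Point n} →
              IsPath q p (suc n) (q ∷ q′ ∷ rs) → IsPath q′ p n (q′ ∷ rs)
IsPath-tail (_ , lst , adj) = refl , lst , adj ∘ suc

-- Shortest paths to a fixed target

∣i-x∣≤1+∣i-x′∣ : ∀ i x x′ → ∣ x ℤ.- x′ ∣ ≡ 1 → ∣ i ℤ.- x ∣ ≤ suc ∣ i ℤ.- x′ ∣
∣i-x∣≤1+∣i-x′∣ i x x′ u = ≤-trans (triangle i x x′) (≤-reflexive (cong (_+ ∣ i ℤ.- x′ ∣) u))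

module _ (i j k : ℤ) where

  private
    p : Point
    p = i , j , k

  dist : Point → ℕ
  dist (x , y , z) = ∣ i ℤ.- x ∣ + ∣ j ℤ.- y ∣ + ∣ k ℤ.- z ∣

  dist-step : ∀ {r s} → Step r s → dist r ≤ suc (dist s)
  dist-step stay = n≤1+n _
  dist-step (along-x {x} {x′} u) = +-monoˡ-≤ _ (+-monoˡ-≤ _ (∣i-x∣≤1+∣i-x′∣ i x x′ u))
  dist-step (along-y {y} {y′} {x} u) = +-monoˡ-≤ _
    (≤-trans (+-monoʳ-≤ (∣ i ℤ.- x ∣) (∣i-x∣≤1+∣i-x′∣ j y y′ u)) (≤-reflexive (+-suc _ _)))
  dist-step (along-z {z} {z′} u) =
    ≤-trans (+-monoʳ-≤ _ (∣i-x∣≤1+∣i-x′∣ k z z′ u)) (≤-reflexive (+-suc _ _))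

  dist-target : dist p ≡ 0
  dist-target rewrite ∣i-i∣≡0 i | ∣i-i∣≡0 j | ∣i-i∣≡0 k = refl

  dist≤length : ∀ {n q r} → IsPath q p n r → dist q ≤ n
  dist≤length {r = _ ∷ []}     (refl , refl , _) = ≤-reflexive dist-target
  dist≤length {r = _ ∷ _ ∷ _} path@(refl , _ , adj) =
    ≤-trans (dist-step (∈N₆⇒Step (adj zero))) (s≤s (dist≤length (IsPath-tail path)))

  -- The starting point is left out. The letter counts are not tied to the distances here; that link
  -- enters as hypotheses of the lemmas below.
  steps : Point → Word n a b c → Vec Point n
  steps q           []        = []
  steps (x , y , z) (xstep w) = (toward i x , y , z) ∷ steps (toward i x , y , z) w
  steps (x , y , z) (ystep w) = (x , toward j y , z) ∷ steps (x , toward j y , z) w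
  steps (x , y , z) (zstep w) = (x , y , toward k z) ∷ steps (x , y , toward k z) w

  -- Invariant: the letters left in each direction equal the remaining distance in that coordinate.
  -- At the empty word all three distances are zero, so the point reached is `p`.
  steps-isPath : ∀ (w : Word n a b c) →
                 ∣ i ℤ.- x ∣ ≡ a → ∣ j ℤ.- y ∣ ≡ b → ∣ k ℤ.- z ∣ ≡ c →
                 IsPath (x , y , z) p n ((x , y , z) ∷ steps (x , y , z) w)
  steps-isPath {x = x} {y} {z} [] da db dc
    with refl ← ∣i-j∣≡0⇒i≡j i x da | refl ← ∣i-j∣≡0⇒i≡j j y db | refl ← ∣i-j∣≡0⇒i≡j k z dc
    = refl , refl , λ ()
  steps-isPath {x = x} (xstep w) da db dc =
    IsPath-∷ (along-x (∣x-toward∣≡1 i x da)) (steps-isPath w (∣i-toward∣ i x da) db dc)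
  steps-isPath {y = y} (ystep w) da db dc =
    IsPath-∷ (along-y (∣x-toward∣≡1 j y db)) (steps-isPath w da (∣i-toward∣ j y db) dc)
  steps-isPath {z = z} (zstep w) da db dc =
    IsPath-∷ (along-z (∣x-toward∣≡1 k z dc)) (steps-isPath w da db (∣i-toward∣ k z dc))

  steps-injective : ∀ (w w′ : Word n a b c) →
                    ∣ i ℤ.- x ∣ ≡ a → ∣ j ℤ.- y ∣ ≡ b → ∣ k ℤ.- z ∣ ≡ c →
                    steps (x , y , z) w ≡ steps (x , y , z) w′ → w ≡ w′
  steps-injective [] [] _ _ _ _ = refl
  steps-injective {x = x} (xstep w) (xstep w′) da db dc eq =
    cong xstep (steps-injective w w′ (∣i-toward∣ i x da) db dc (∷-injectiveʳ eq))
  steps-injective {y = y} (ystep w) (ystep w′) da db dc eq =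
    cong ystep (steps-injective w w′ da (∣i-toward∣ j y db) dc (∷-injectiveʳ eq))
  steps-injective {z = z} (zstep w) (zstep w′) da db dc eq =
    cong zstep (steps-injective w w′ da db (∣i-toward∣ k z dc) (∷-injectiveʳ eq))
  -- With different first letters, one path at once moves a coordinate that the other keeps, so
  -- already the first points differ.
  steps-injective {x = x} (xstep _) (ystep _) da db dc eq =
    contradiction (cong proj₁ (∷-injectiveˡ eq)) (toward≢ i x da)
  steps-injective {x = x} (xstep _) (zstep _) da db dc eq =
    contradiction (cong proj₁ (∷-injectiveˡ eq)) (toward≢ i x da)
  steps-injective {y = y} (ystep _) (xstep _) da db dc eq =
    contradiction (cong (proj₁ ∘ proj₂) (∷-injectiveˡ eq)) (toward≢ j y db)
  steps-injective {y = y} (ystep _) (zstep _) da db dc eq =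
    contradiction (cong (proj₁ ∘ proj₂) (∷-injectiveˡ eq)) (toward≢ j y db)
  steps-injective {z = z} (zstep _) (xstep _) da db dc eq =
    contradiction (cong (proj₂ ∘ proj₂) (∷-injectiveˡ eq)) (toward≢ k z dc)
  steps-injective {z = z} (zstep _) (ystep _) da db dc eq =
    contradiction (cong (proj₂ ∘ proj₂) (∷-injectiveˡ eq)) (toward≢ k z dc)

  -- Reading a word off a path of minimal length

  Spelling : Point → (a b c : ℕ) → Vec Point n → Set
  Spelling {n} q a b c rs = Σ (Word n a b c) λ w → steps q w ≡ rs

  -- The target and the letter count are variables constrained by equations, so that both equations
  -- can be matched with `refl`; for `∣ i ℤ.- x ∣` itself this would fail.
  spell-x : ∀ {rs : Vec Point n} → x′ ≡ toward i x → a ≡ suc ∣ i ℤ.- x′ ∣ →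
            Spelling (x′ , y , z) (∣ i ℤ.- x′ ∣) b c rs →
            Spelling (x , y , z) a b c ((x′ , y , z) ∷ rs)
  spell-x refl refl (w , refl) = xstep w , refl

  spell-y : ∀ {rs : Vec Point n} → y′ ≡ toward j y → b ≡ suc ∣ j ℤ.- y′ ∣ →
            Spelling (x , y′ , z) a (∣ j ℤ.- y′ ∣) c rs →
            Spelling (x , y , z) a b c ((x , y′ , z) ∷ rs)
  spell-y refl refl (w , refl) = ystep w , refl

  spell-z : ∀ {rs : Vec Point n} → z′ ≡ toward k z → c ≡ suc ∣ k ℤ.- z′ ∣ →
            Spelling (x , y , z′) a b (∣ k ℤ.- z′ ∣) rs →
            Spelling (x , y , z) a b c ((x , y , z′) ∷ rs)
  spell-z refl refl (w , refl) = zstep w , refl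

  spell : ∀ (rs : Vec Point n) → IsPath (x , y , z) p n ((x , y , z) ∷ rs) →
          dist (x , y , z) ≡ n →
          Spelling (x , y , z) (∣ i ℤ.- x ∣) (∣ j ℤ.- y ∣) (∣ k ℤ.- z ∣) rs
  spell [] (refl , refl , _) _
    rewrite ∣i-i∣≡0 i | ∣i-i∣≡0 j | ∣i-i∣≡0 k = [] , refl
  spell {n = suc n} {x} {y} {z} (s@(x₁ , y₁ , z₁) ∷ rs) path@(_ , _ , adj) dist≡1+n
    = spell-by step (spell rs tail dist-s≡n)
    where
    step : Step (x , y , z) s
    step = ∈N₆⇒Step (adj zero)

    tail : IsPath s p n (s ∷ rs)
    tail = IsPath-tail path

    -- The tail has length `n`, so `dist s` is at most `n`, while the distance before the step is
    -- `suc n`.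
    approaching : dist (x , y , z) ≤ dist s → ⊥
    approaching = <⇒≱ (≤-trans (s≤s (dist≤length tail)) (≤-reflexive (sym dist≡1+n)))

    -- At most `n` by the length of the tail, at least `n` because one step lowers the distance by
    -- at most 1.
    dist-s≡n : dist s ≡ n
    dist-s≡n = ≤-antisym (dist≤length tail)
      (s≤s⁻¹ (≤-trans (≤-reflexive (sym dist≡1+n)) (dist-step step)))

    spell-by : Step (x , y , z) s →
               Spelling s (∣ i ℤ.- x₁ ∣) (∣ j ℤ.- y₁ ∣) (∣ k ℤ.- z₁ ∣) rs →
               Spelling (x , y , z) (∣ i ℤ.- x ∣) (∣ j ℤ.- y ∣) (∣ k ℤ.- z ∣) (s ∷ rs)
    spell-by stay        = contradiction ≤-refl approaching
    spell-by (along-x u) = spell-x (toward-unique i x x₁ u d) d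
      where
      d : ∣ i ℤ.- x ∣ ≡ suc ∣ i ℤ.- x₁ ∣
      -- If the moved coordinate came no closer, the total distance would not drop either, the other
      -- two terms being unchanged; this contradicts `approaching`.
      d = ≤-antisym (∣i-x∣≤1+∣i-x′∣ i x x₁ u) (≰⇒> (approaching ∘ +-monoˡ-≤ _ ∘ +-monoˡ-≤ _))
    spell-by (along-y u) = spell-y (toward-unique j y y₁ u d) d
      where
      d : ∣ j ℤ.- y ∣ ≡ suc ∣ j ℤ.- y₁ ∣
      d = ≤-antisym (∣i-x∣≤1+∣i-x′∣ j y y₁ u) (≰⇒> (approaching ∘ +-monoˡ-≤ _ ∘ +-monoʳ-≤ (∣ i ℤ.- x ∣)))
    spell-by (along-z u) = spell-z (toward-unique k z z₁ u d) d
      where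
      d : ∣ k ℤ.- z ∣ ≡ suc ∣ k ℤ.- z₁ ∣
      d = ≤-antisym (∣i-x∣≤1+∣i-x′∣ k z z₁ u) (≰⇒> (approaching ∘ +-monoʳ-≤ _))

  -- The bijection between words and shortest paths

  module _ (x y z : ℤ) where

    private
      q : Point
      q = x , y , z

      Geodesic : Set
      Geodesic = Word (dist q) (∣ i ℤ.- x ∣) (∣ j ℤ.- y ∣) (∣ k ℤ.- z ∣)

      sequence : Geodesic → Σ ℕ λ n → Vec Point (suc n)
      sequence w = dist q , q ∷ steps q w

      sequence-injective : ∀ {w w′} → sequence w ≡ sequence w′ → w ≡ w′
      sequence-injective {w} {w′} eq = steps-injective w w′ refl refl refl
        -- The lengths coincide, and uniqueness of identity proofs on ℕ turns equality of the
        -- dependent pairs into equality of the vectors.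
        (∷-injectiveʳ (,-injectiveʳ-UIP ≡-irrelevant eq))

      toPath : Geodesic → ShortestPath q p
      toPath w = record
        { len     = dist q
        ; points  = q ∷ steps q w
        ; isPath  = steps-isPath w refl refl refl
        ; minimal = λ _ _ → dist≤length
        }

      -- Stated for a variable length `n`, so that `dist q ≡ n` can be matched with `refl`; the
      -- field `len` of a path would not allow this.
      fromSequence : (r : Vec Point (suc n)) → IsPath q p n r → dist q ≡ n →
                     Σ Geodesic λ w → sequence w ≡ (n , r)
      fromSequence (_ ∷ rs) path@(refl , _) refl with w , eq ← spell rs path refl =
        w , cong (λ rs → dist q , q ∷ rs) eq

      fromPath : (π : ShortestPath q p) →
                 Σ Geodesic λ w → sequence w ≡ ShortestPath.pointSequence π
      fromPath π = fromSequence points isPath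
        (≤-antisym (dist≤length isPath)
                   (minimal (dist q) _ (ShortestPath.isPath (toPath (someWord _ _ _)))))
        where open ShortestPath π

    -- All laws follow from two facts: `sequence` is injective, and `fromPath` returns a word with
    -- the same point sequence as the given path.
    Word↔shortestPaths : Inverse (setoid Geodesic) (shortestPaths q p)
    Word↔shortestPaths = record
      { to        = toPath
      ; from      = proj₁ ∘ fromPath
      ; to-cong   = cong sequence
      ; from-cong = λ {π} {π′} eq → sequence-injective
          (trans (proj₂ (fromPath π)) (trans eq (sym (proj₂ (fromPath π′)))))
      ; inverse   = (λ { {π} refl → proj₂ (fromPath π) })
                  , λ {w} {π} eq → sequence-injective (trans (proj₂ (fromPath π)) eq)
      }

    shortestPaths-cardinality :
      HasCardinality (shortestPaths q p)
                     (count (dist q) (∣ i ℤ.- x ∣) (∣ j ℤ.- y ∣) (∣ k ℤ.- z ∣))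
    shortestPaths-cardinality = inverse (count-↔ _ _ _ _) Word↔shortestPaths

-- The count as a quotient of factorials

*≡⇒≡/ : ∀ f N d .{{_ : NonZero d}} → f * d ≡ N → (+ f) / 1 ≡ (+ N) / d
-- Equality of unnormalised fractions is cross-multiplication. `mkℚᵘ` stores the denominator minus
-- one, so 0 stands for 1 and `d` for `suc d`.
*≡⇒≡/ f N (suc d) f*d≡N = fromℚᵘ-cong {mkℚᵘ (+ f) 0} {mkℚᵘ (+ N) d} (*≡* (begin
  + f ℤ.* + suc d  ≡⟨ ℤ.pos-* f (suc d) ⟨
  + (f * suc d)    ≡⟨ cong +_ f*d≡N ⟩
  + N              ≡⟨ ℤ.*-identityʳ (+ N) ⟨
  + N ℤ.* 1ℤ       ∎))
  where open ≡-Reasoning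

count-multinomial : ∀ a b c →
  (+ count (a + b + c) a b c) / 1 ≡
  _/_ (+ ((a + b + c) !)) (a ! * b ! * c !) {{factorials≢0 a b c}}
count-multinomial a b c =
  *≡⇒≡/ (count (a + b + c) a b c) _ _ {{factorials≢0 a b c}} (count-*-! _ a b c refl)

theorem3p1 : (i j k : ℤ) →
    Σ ℕ λ f →
    HasCardinality (shortestPaths (0ℤ , 0ℤ , 0ℤ) (i , j , k)) f
    × (+ f) / 1 ≡ _/_ (+ ((∣ i ∣ + ∣ j ∣ + ∣ k ∣) !)) (∣ i ∣ ! * ∣ j ∣ ! * ∣ k ∣ !) {{factorials≢0 (∣ i ∣) (∣ j ∣) (∣ k ∣)}}
theorem3p1 i j k
  -- `card` is bound before the rewriting, which then turns the distances from the origin in its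
  -- type into `∣ i ∣`, `∣ j ∣` and `∣ k ∣`.
  with card ← shortestPaths-cardinality i j k 0ℤ 0ℤ 0ℤ
  rewrite ℤ.+-identityʳ i | ℤ.+-identityʳ j | ℤ.+-identityʳ k =
  _ , card , count-multinomial (∣ i ∣) (∣ j ∣) (∣ k ∣)
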